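{- (i) Every ABA-free hypergraph has chromatic number at most $3$; (ii) every pseudohalfplane hypergraph has chromatic number at most $4$; (iii) every dual pseudohalfplane hypergraph has chromatic number at most $3$. Moreover these bounds are best possible: there exist an ABA-free hypergraph and a dual pseudohalfplane hypergraph with chromatic number $3$, and a pseudohalfplane hypergraph with chromatic number $4$.
   Context: A hypergraph $\mathcal{F}$ on a totally ordered finite vertex set $V$ (a family of subsets of $V$) is ABA-free if there are no two hyperedges $A,B\in\mathcal{F}$ and vertices $x<y<z$ with $x,z\in A\setminus B$ and $y\in B\setminus A$. For a family $\mathcal{F}$ of subsets of $V$ let $\bar{\mathcal{F}}=\{V\setminus F: F\in\mathcal{F}\}$. A hypergraph $\mathcal{H}$ on $V$ is a pseudohalfplane hypergraph if there exists an ABA-free hypergraph $\mathcal{F}$ on $V$ such that $\mathcal{H}\subseteq\mathcal{F}\cup\bar{\mathcal{F}}$. The dual of a hypergraph $\mathcal{H}$ is the hypergraph whose vertices are the hyperedges of $\mathcal{H}$ and which has, for each vertex $v$ of $\mathcal{H}$, the hyperedge $\{H\in\mathcal{H}: v\in H\}$; a dual pseudohalfplane hypergraph is a hypergraph isomorphic to the dual of a pseudohalfplane hypergraph. A proper $k$-coloring of a hypergraph assigns one of $k$ colors to each vertex so that no hyperedge with at least two vertices is monochromatic; the chromatic number is the least such $k$. -}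

module Defs where

open import Data.Nat using (ℕ; _≥_; zero; suc)
open import Data.Fin using (Fin; _<_)
open import Data.Fin.Subset using (Subset; _∈_; _∉_; ∁; ∣_∣)
open import Data.Vec using (Vec; lookup; tabulate)
open import Data.List using (List; length)
import Data.List as L
open import Data.List.Membership.Propositional using () renaming (_∈_ to _∈ₗ_)
open import Data.List.Relation.Unary.Unique.Propositional using (Unique)
open import Data.Product using (Σ; ∃; ∃-syntax; _×_; _,_)
open import Data.Sum using (_⊎_)
open import Data.Empty using (⊥)
open import Relation.Nullary using (¬_)
open import Relation.Binary.PropositionalEquality using (_≡_; _≢_)
open import Function.Bundles using (_↔_; Inverse)

-- A hypergraph on the totally ordered vertex set Fin n (ordered by the usual
-- order of Fin n) is a finite family of subsets, given as a list of subsets.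
Hypergraph : ℕ → Set
Hypergraph n = List (Subset n)

ABA-free : {n : ℕ} → Hypergraph n → Set
ABA-free {n} F =
  ∀ (A B : Subset n) → A ∈ₗ F → B ∈ₗ F →
  ∀ (x y z : Fin n) → x < y → y < z →
  x ∈ A → x ∉ B → z ∈ A → z ∉ B → y ∈ B → y ∉ A → ⊥

Pseudohalfplane : {n : ℕ} → Hypergraph n → Set
Pseudohalfplane {n} H =
  ∃[ F ] (ABA-free F ×
    (∀ (E : Subset n) → E ∈ₗ H → (E ∈ₗ F) ⊎ (∃[ G ] (G ∈ₗ F × E ≡ ∁ G))))

-- The dual of H: vertices are the hyperedges of H (indices into the list;
-- H is required to be duplicate-free when this is used), and for each vertex v
-- of H there is the hyperedge {i | v ∈ H_i}.
dual : {n : ℕ} (H : Hypergraph n) → Hypergraph (length H)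
dual {n} H = L.map (λ v → tabulate (λ i → lookup (lookupH i) v)) (L.allFin n)
  where
  lookupH : Fin (length H) → Subset n
  lookupH i = L.lookup H i

image : {m m' : ℕ} → (Fin m ↔ Fin m') → Subset m → Subset m'
image f E = tabulate (λ i → lookup E (Inverse.from f i))

-- isomorphism of hypergraphs (families of sets; list multiplicity irrelevant)
Isomorphic : {m m' : ℕ} → Hypergraph m → Hypergraph m' → Set
Isomorphic {m} {m'} G D =
  Σ (Fin m ↔ Fin m') λ f →
    (∀ E → E ∈ₗ G → image f E ∈ₗ D) ×
    (∀ E → E ∈ₗ D → ∃[ E' ] (E' ∈ₗ G × image f E' ≡ E))

DualPseudohalfplane : {m : ℕ} → Hypergraph m → Set
DualPseudohalfplane {m} G =
  ∃[ n ] ∃[ H ] (Unique {A = Subset n} H × Pseudohalfplane H × Isomorphic G (dual H))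

ProperColoring : {n : ℕ} → Hypergraph n → (k : ℕ) → (Fin n → Fin k) → Set
ProperColoring {n} H k c =
  ∀ (E : Subset n) → E ∈ₗ H → ∣ E ∣ ≥ 2 →
  ∃[ x ] ∃[ y ] (x ∈ E × y ∈ E × c x ≢ c y)

Colorable : {n : ℕ} → Hypergraph n → ℕ → Set
Colorable {n} H k = ∃[ c ] ProperColoring H k c

ChromaticAtMost : {n : ℕ} → Hypergraph n → ℕ → Set
ChromaticAtMost H k = Colorable H k

ChromaticEq : {n : ℕ} → Hypergraph n → ℕ → Set
ChromaticEq H zero = Colorable H 0
ChromaticEq H (suc k) = Colorable H (suc k) × ¬ Colorable H k

{-# OPTIONS --safe #-}
-- Call a family ABAB-free for a total order if no x < y < z < w have x, z ∈ A ∖ B and y, w ∈ B ∖ A.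
-- The two-element traces of such a family on any vertex set form a noncrossing graph, so some vertex v
-- has degree at most 2 in it; a 3-colouring of the traces on the other vertices extends to v. ABA-free
-- families are ABAB-free, and so are duals of pseudohalfplane hypergraphs, once the sets are sorted by
-- putting members of F before complements of members and ordering each class lexicographically.
--
-- For pseudohalfplanes, call a vertex unskippable if no set of F avoids it while having elements on both
-- sides. Deleting a skippable vertex keeps the others skippable, so every nonempty set of F contains an
-- unskippable vertex, and the unskippable vertices it contains are consecutive. The unskippable vertices
-- of F and those of the complements form two monotone paths, which are 3-coloured together greedily; the
-- fourth colour is left to the remaining vertices. Complete graphs on 3 and 4 vertices show sharpness.
module Submission where

open import Defs
open import Data.Bool using (Bool; true; false; not)
import Data.Bool as Bool
open import Data.Bool.Properties using (not-involutive)
open import Data.Empty using (⊥; ⊥-elim)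
open import Data.Fin using (Fin; zero; suc; _≟_; _<_; inject₁; fromℕ)
open import Data.Fin.Patterns using (0F; 1F)
open import Data.Fin.Properties using
  (any?; all?; _<?_; pigeonhole; suc-injective; <⇒≢; <-cmp; <-asym; <-isStrictTotalOrder;
   fromℕ≢inject₁; inject₁-injective; ≤fromℕ; ≤∧≢⇒<)
open import Data.Fin.Subset using (Subset; _∈_; _∉_; ∣_∣; inside; outside; ∁; ⁅_⁆; _∪_)
open import Data.Fin.Subset.Properties using
  (_∈?_; x∉∁p⇒x∈p; x∈∁p⇒x∉p; x∉p⇒x∈∁p; x∈p⇒∣p-x∣<∣p∣; x∈p∧x≢y⇒x∈p-y; x∈p∪q⁻; x∈⁅y⁆⇒x≡y)
open import Data.List as L using (List; []; _∷_; filter; length; allFin; _++_)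
import Data.List.Membership.DecPropositional as DecMembership
open import Data.List.Membership.Propositional using (find; lose) renaming (_∈_ to _∈ₗ_; _∉_ to _∉ₗ_)
open import Data.List.Membership.Propositional.Properties using
  (∈-filter⁺; ∈-filter⁻; ∈-allFin; ∈-map⁺; ∈-map⁻; ∈-++⁻; ∈-lookup)
open import Data.List.Properties using (filter-notAll)
open import Data.List.Relation.Unary.All as All using (All; []; _∷_)
open import Data.List.Relation.Unary.All.Properties using (¬All⇒Any¬)
open import Data.List.Relation.Unary.AllPairs using (AllPairs; []; _∷_)
import Data.List.Relation.Unary.AllPairs.Properties as AllPairs
open import Data.List.Relation.Unary.Any as Any using (Any; here; there)
open import Data.List.Relation.Unary.Unique.DecPropositional using (unique?)
open import Data.List.Relation.Unary.Unique.Propositional using (Unique)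
open import Data.Nat using (ℕ; zero; suc; z≤n; s≤s; z<s; s<s; _≥_; _≥?_)
import Data.Nat as ℕ
open import Data.Nat.Induction using (<-wellFounded)
import Data.Nat.Properties as ℕ
open import Data.Product using (∃; ∃-syntax; ∃₂; _×_; _,_; proj₁; proj₂)
open import Data.Sum using (_⊎_; inj₁; inj₂; swap)
open import Data.Vec using ([]; _∷_; _∷ʳ_; here; there; lookup; tabulate)
open import Data.Vec.Properties using
  ([]=⇒lookup; lookup⇒[]=; lookup∘tabulate; tabulate∘lookup; ∷-injectiveʳ; map-∘; map-id; map-cong; ≡-dec)
open import Function using (_∘_; _on_; flip; id; Inverse; Injection; _↔_)
open import Function.Construct.Identity using (↔-id)
open import Function.Properties.Inverse using (↔⇒↣)
open import Induction.WellFounded using (Acc; acc)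
open import Level using (0ℓ)
open import Relation.Binary using (Rel; IsStrictTotalOrder; Trichotomous; Tri; tri<; tri≈; tri>)
import Relation.Binary.Construct.Flip.EqAndOrd as Flip
open import Relation.Binary.PropositionalEquality using
  (_≡_; _≢_; refl; sym; trans; cong; subst; ≢-sym; isEquivalence)
open import Relation.Binary.Structures.Biased using (isStrictTotalOrderᶜ)
open import Relation.Nullary using (¬_; Dec; yes; no; ¬?; contradiction)
open import Relation.Nullary.Decidable using (_×-dec_; _→-dec_; _⊎-dec_; decidable-stable; True; toWitness)
open import Relation.Unary using (Pred; Decidable)

private variable
  n k m : ℕ

-- Elements of subsets and spare colours

nonempty : (E : Subset n) → ∣ E ∣ ≥ 1 → ∃ λ x → x ∈ E
nonempty (inside  ∷ E) _ = zero , here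
nonempty (outside ∷ E) p with x , x∈E ← nonempty E p = suc x , there x∈E

twoElements : (E : Subset n) → ∣ E ∣ ≥ 2 → ∃₂ λ x y → x ≢ y × x ∈ E × y ∈ E
twoElements (inside  ∷ E) (s≤s p) with y , y∈E ← nonempty E p =
  zero , suc y , (λ ()) , here , there y∈E
twoElements (outside ∷ E) p with x , y , x≢y , x∈E , y∈E ← twoElements E p =
  suc x , suc y , x≢y ∘ suc-injective , there x∈E , there y∈E

Separates : {C : Set} → (Fin n → C) → Subset n → Set
Separates c E = ∃₂ λ x y → x ∈ E × y ∈ E × c x ≢ c y

-- Pigeonhole: if each of the `suc k` colours were a value of `f`, two of them would be hit by the
-- same index.
freshColour : (f : Fin k → Fin (suc k)) → ∃ λ d → ∀ i → d ≢ f i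
freshColour {k} f with any? (λ d → all? (λ i → ¬? (d ≟ f i)))
... | yes p = p
... | no ¬p = ⊥-elim (<⇒≢ i<j (trans (proj₂ (hits i)) (trans (cong f eq) (sym (proj₂ (hits j))))))
  where
  hits : ∀ d → ∃ λ i → d ≡ f i
  hits d = decidable-stable (any? (λ i → d ≟ f i)) (λ ¬q → ¬p (d , λ i d≡fi → ¬q (i , d≡fi)))
  collision = pigeonhole (ℕ.n<1+n k) (proj₁ ∘ hits)
  i = proj₁ collision
  j = proj₁ (proj₂ collision)
  i<j = proj₁ (proj₂ (proj₂ collision))
  eq = proj₂ (proj₂ (proj₂ collision))

-- ABAB-free hypergraphs

-- The order is a parameter because the vertices of a dual are list indices, which have to be
-- re-sorted.
ABAB-free : Rel (Fin m) 0ℓ → Hypergraph m → Set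
ABAB-free _⊏_ H =
  ∀ {A B x y z w} → A ∈ₗ H → B ∈ₗ H → x ⊏ y → y ⊏ z → z ⊏ w →
  x ∈ A → x ∉ B → y ∈ B → y ∉ A → z ∈ A → z ∉ B → w ∈ B → w ∉ A → ⊥

module ABABColouring
  {_⊏_ : Rel (Fin m) 0ℓ} (isSTO : IsStrictTotalOrder _≡_ _⊏_)
  {H : Hypergraph m} (abab : ABAB-free _⊏_ H) where

  open IsStrictTotalOrder isSTO using (compare) renaming (irrefl to ⊏-irrefl; trans to ⊏-trans)

  insert : ∀ v {L} → AllPairs _⊏_ L →
           ∃ λ L′ → AllPairs _⊏_ L′ × (∀ {w} → w ∈ₗ L′ → w ∈ₗ v ∷ L) × (∀ {w} → w ∈ₗ v ∷ L → w ∈ₗ L′)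
  insert v {[]} [] = v ∷ [] , [] ∷ [] , (λ p → p) , (λ p → p)
  insert v {u ∷ L} (u⊏L ∷ sorted) with compare v u
  ... | tri< v⊏u _ _ = v ∷ u ∷ L , (v⊏u ∷ All.map (⊏-trans v⊏u) u⊏L) ∷ u⊏L ∷ sorted , (λ p → p) , (λ p → p)
  ... | tri≈ _ refl _ = u ∷ L , u⊏L ∷ sorted , there , λ { (here p) → here p ; (there p) → p }
  ... | tri> _ _ u⊏v with L′ , sorted′ , to , from ← insert v sorted =
    u ∷ L′ , All.tabulate (λ p → below (to p)) ∷ sorted′ ,
    (λ { (here p) → there (here p) ; (there p) → shift (to p) }) ,
    (λ { (here p) → there (from (here p)) ; (there (here p)) → here p ; (there (there p)) → there (from (there p)) })
    where
    below : ∀ {w} → w ∈ₗ v ∷ L → u ⊏ w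
    below (here refl) = u⊏v
    below (there p)   = All.lookup u⊏L p
    shift : ∀ {w} → w ∈ₗ v ∷ L → w ∈ₗ v ∷ u ∷ L
    shift (here p)  = here p
    shift (there p) = there (there p)

  sort : ∀ L → ∃ λ L′ → AllPairs _⊏_ L′ × (∀ {w} → w ∈ₗ L → w ∈ₗ L′)
  sort [] = [] , [] , λ p → p
  sort (v ∷ L) with L₁ , sorted₁ , from₁ ← sort L with L₂ , sorted₂ , _ , from₂ ← insert v sorted₁ =
    L₂ , sorted₂ , λ { (here p) → from₂ (here p) ; (there p) → from₂ (there (from₁ p)) }

  -- The graph of two-element traces of `H` on `L`. Membership of the ends in `L` is supplied
  -- separately.
  Edge : List (Fin m) → Fin m → Fin m → Set
  Edge L v w = v ≢ w × Any (λ A → v ∈ A × w ∈ A × All (λ z → z ∈ A → z ≡ v ⊎ z ≡ w) L) H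

  edge? : ∀ L v w → Dec (Edge L v w)
  edge? L v w = ¬? (v ≟ w) ×-dec
    Any.any? (λ A → v ∈? A ×-dec w ∈? A ×-dec
      All.all? (λ z → z ∈? A →-dec ((z ≟ v) ⊎-dec (z ≟ w))) L) H

  edge-sym : ∀ {L v w} → Edge L v w → Edge L w v
  edge-sym (v≢w , any) = ≢-sym v≢w ,
    Any.map (λ (v∈A , w∈A , only) → w∈A , v∈A , All.map (λ f z∈A → swap (f z∈A)) only) any

  -- Hyperedges with the traces `x`, `z` and `y`, `w` would alternate on these four vertices.
  noncrossing : ∀ {L x y z w} → x ∈ₗ L → y ∈ₗ L → z ∈ₗ L → w ∈ₗ L →
                x ⊏ y → y ⊏ z → z ⊏ w → Edge L x z → Edge L y w → ⊥
  noncrossing x∈L y∈L z∈L w∈L x⊏y y⊏z z⊏w (_ , xz) (_ , yw)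
    with A , A∈H , x∈A , z∈A , onlyA ← find xz | B , B∈H , y∈B , w∈B , onlyB ← find yw =
    abab A∈H B∈H x⊏y y⊏z z⊏w
      x∈A (outside-pair onlyB x∈L (⊏-≢ x⊏y) (⊏-≢ (⊏-trans x⊏y (⊏-trans y⊏z z⊏w))))
      y∈B (outside-pair onlyA y∈L (≢-sym (⊏-≢ x⊏y)) (⊏-≢ y⊏z))
      z∈A (outside-pair onlyB z∈L (≢-sym (⊏-≢ y⊏z)) (⊏-≢ z⊏w))
      w∈B (outside-pair onlyA w∈L (≢-sym (⊏-≢ (⊏-trans x⊏y (⊏-trans y⊏z z⊏w)))) (≢-sym (⊏-≢ z⊏w)))
    where
    ⊏-≢ : ∀ {a b} → a ⊏ b → a ≢ b
    ⊏-≢ a⊏b a≡b = ⊏-irrefl a≡b a⊏b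
    outside-pair : ∀ {L A u v t} → All (λ z → z ∈ A → z ≡ u ⊎ z ≡ v) L → t ∈ₗ L → t ≢ u → t ≢ v → t ∉ A
    outside-pair only t∈L t≢u t≢v t∈A with All.lookup only t∈L t∈A
    ... | inj₁ t≡u = t≢u t≡u
    ... | inj₂ t≡v = t≢v t≡v

  -- `a` and `b` may coincide and need not be neighbours of `v`.
  DegreeAtMost2 : List (Fin m) → Fin m → Set
  DegreeAtMost2 L v = ∃₂ λ a b → ∀ {w} → w ∈ₗ L → Edge L v w → w ≡ a ⊎ w ≡ b

  -- Under a chord xy, where x ∷ v ∷ ys is a final segment of L, either v has no graph neighbours
  -- besides its two neighbours in the order, or v starts a chord under xy.
  degreeAtMost2-under : ∀ {L x v y} ys → AllPairs _⊏_ (x ∷ v ∷ ys) → x ∈ₗ L →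
    (∀ {w} → w ∈ₗ v ∷ ys → w ∈ₗ L) → (∀ {w} → w ∈ₗ L → x ⊏ w → w ∈ₗ v ∷ ys) →
    Edge L x y → y ∈ₗ ys → ∃ λ v → v ∈ₗ L × DegreeAtMost2 L v
  degreeAtMost2-under {L} {x} {v} {y} (u ∷ ys) ((x⊏v ∷ x⊏u ∷ x⊏ys) ∷ (v⊏u ∷ v⊏ys) ∷ sorted) x∈L ys⊆L after xy y∈ys
    with Any.any? (edge? L v) ys
  -- The search moves under the chord `vw`, over a shorter final segment.
  ... | yes chord with w , w∈ys , vw ← find chord =
    degreeAtMost2-under ys ((v⊏u ∷ v⊏ys) ∷ sorted) (ys⊆L (here refl)) (ys⊆L ∘ there) after′ vw w∈ys
    where
    after′ : ∀ {w} → w ∈ₗ L → v ⊏ w → w ∈ₗ u ∷ ys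
    after′ w∈L v⊏w with after w∈L (⊏-trans x⊏v v⊏w)
    ... | here refl = contradiction v⊏w (⊏-irrefl refl)
    ... | there p   = p
  ... | no ¬chord = v , ys⊆L (here refl) , x , u , only
    where
    v⊏y : v ⊏ y
    v⊏y = All.lookup (v⊏u ∷ v⊏ys) y∈ys
    only : ∀ {w} → w ∈ₗ L → Edge L v w → w ≡ x ⊎ w ≡ u
    only {w} w∈L vw with compare w x
    -- A neighbour before `x` would give a chord crossing `xy`.
    ... | tri< w⊏x _ _ = ⊥-elim (noncrossing w∈L x∈L (ys⊆L (here refl)) (ys⊆L (there y∈ys)) w⊏x x⊏v v⊏y (edge-sym vw) xy)
    ... | tri≈ _ w≡x _ = inj₁ w≡x
    ... | tri> _ _ x⊏w with after w∈L x⊏w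
    ...   | here w≡v = contradiction (sym w≡v) (proj₁ vw)
    ...   | there (here w≡u) = inj₂ w≡u
    ...   | there (there w∈ys) = contradiction (lose w∈ys vw) ¬chord

  -- Either the first vertex has no neighbour beyond its successor, or it starts a chord to descend
  -- under.
  degreeAtMost2-exists : ∀ {x ys} → AllPairs _⊏_ (x ∷ ys) → ∃ λ v → v ∈ₗ x ∷ ys × DegreeAtMost2 (x ∷ ys) v
  degreeAtMost2-exists {x} {[]} _ = x , here refl , x , x , λ { (here p) _ → inj₁ p }
  degreeAtMost2-exists {x} {v ∷ ys} sorted with Any.any? (edge? (x ∷ v ∷ ys) x) ys
  ... | yes chord with y , y∈ys , xy ← find chord =
    degreeAtMost2-under ys sorted (here refl) there
      (λ { (here refl) x⊏x → contradiction x⊏x (⊏-irrefl refl) ; (there p) _ → p }) xy y∈ys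
  ... | no ¬chord = x , here refl , x , v ,
    λ { (here p) _ → inj₁ p ; (there (here p)) _ → inj₂ p ; (there (there p)) xw → contradiction (lose p xw) ¬chord }

  -- Two distinct common elements of `L` and `A` stand for the size condition on the trace, so no
  -- trace has to be built as a set.
  ProperOn : List (Fin m) → (Fin m → Fin 3) → Set
  ProperOn L c = ∀ {A x y} → A ∈ₗ H → x ∈ₗ L → y ∈ₗ L → x ∈ A → y ∈ A → x ≢ y →
    ∃₂ λ x y → x ∈ₗ L × y ∈ₗ L × x ∈ A × y ∈ A × c x ≢ c y

  recolour : (Fin m → Fin 3) → Fin m → Fin 3 → Fin m → Fin 3
  recolour c v d w with w ≟ v
  ... | yes _ = d
  ... | no  _ = c w

  recolour-≡ : ∀ c v d → recolour c v d v ≡ d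
  recolour-≡ c v d with v ≟ v
  ... | yes _  = refl
  ... | no v≢v = contradiction refl v≢v

  recolour-≢ : ∀ c v d {w} → w ≢ v → recolour c v d w ≡ c w
  recolour-≢ c v d {w} w≢v with w ≟ v
  ... | yes w≡v = contradiction w≡v w≢v
  ... | no _    = refl

  ≢v? : ∀ (v w : Fin m) → Dec (w ≢ v)
  ≢v? v w = ¬? (w ≟ v)

  -- A hyperedge whose trace on L \ v has at least two elements is already bichromatic there, so
  -- only the two-element traces {v , w} restrict the colour of v.
  extend-to : ∀ {L v c} → DegreeAtMost2 L v → ProperOn (filter (≢v? v) L) c → ∃ (ProperOn L)
  extend-to {L} {v} {c} (a , b , only) proper = c′ , proper′
    where
    neighbourColour : Fin 2 → Fin 3
    neighbourColour 0F = c a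
    neighbourColour 1F = c b
    d = proj₁ (freshColour neighbourColour)
    d≢ = proj₂ (freshColour neighbourColour)
    c′ = recolour c v d
    L-v = filter (≢v? v) L

    edge-bichromatic : ∀ {w} → w ∈ₗ L → Edge L v w → c′ v ≢ c′ w
    edge-bichromatic w∈L vw eq with only w∈L vw
    ... | inj₁ refl = d≢ 0F (trans (sym (recolour-≡ c v d)) (trans eq (recolour-≢ c v d (≢-sym (proj₁ vw)))))
    ... | inj₂ refl = d≢ 1F (trans (sym (recolour-≡ c v d)) (trans eq (recolour-≢ c v d (≢-sym (proj₁ vw)))))

    fromRest : ∀ {A x y} → A ∈ₗ H → x ∈ₗ L-v → y ∈ₗ L-v → x ∈ A → y ∈ A → x ≢ y →
      ∃₂ λ x y → x ∈ₗ L × y ∈ₗ L × x ∈ A × y ∈ A × c′ x ≢ c′ y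
    fromRest A∈H x∈ y∈ x∈A y∈A x≢y
      with x′ , y′ , x′∈ , y′∈ , x′∈A , y′∈A , cx≢cy ← proper A∈H x∈ y∈ x∈A y∈A x≢y
      with x′∈L , x′≢v ← ∈-filter⁻ (≢v? v) {xs = L} x′∈ | y′∈L , y′≢v ← ∈-filter⁻ (≢v? v) {xs = L} y′∈ =
      x′ , y′ , x′∈L , y′∈L , x′∈A , y′∈A ,
      λ eq → cx≢cy (trans (sym (recolour-≢ c v d x′≢v)) (trans eq (recolour-≢ c v d y′≢v)))

    withV : ∀ {A w} → A ∈ₗ H → v ∈ₗ L → w ∈ₗ L → v ∈ A → w ∈ A → v ≢ w →
      ∃₂ λ x y → x ∈ₗ L × y ∈ₗ L × x ∈ A × y ∈ A × c′ x ≢ c′ y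
    withV {A} {w} A∈H v∈L w∈L v∈A w∈A v≢w with All.all? (λ z → z ∈? A →-dec ((z ≟ v) ⊎-dec (z ≟ w))) L
    ... | yes pair = v , w , v∈L , w∈L , v∈A , w∈A , edge-bichromatic w∈L (v≢w , lose A∈H (v∈A , w∈A , pair))
    ... | no ¬pair
      -- The trace has a third vertex `z`, so `w` and `z` survive the removal of `v`.
      with z , z∈L , ¬z ← find (¬All⇒Any¬ (λ z → z ∈? A →-dec ((z ≟ v) ⊎-dec (z ≟ w))) L ¬pair) =
      fromRest A∈H (∈-filter⁺ (≢v? v) w∈L (≢-sym v≢w)) (∈-filter⁺ (≢v? v) z∈L (λ z≡v → ¬z (λ _ → inj₁ z≡v)))
        w∈A (decidable-stable (z ∈? A) (λ z∉A → ¬z (λ z∈A → contradiction z∈A z∉A)))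
        (λ w≡z → ¬z (λ _ → inj₂ (sym w≡z)))

    proper′ : ProperOn L c′
    proper′ {x = x} {y} A∈H x∈L y∈L x∈A y∈A x≢y with x ≟ v | y ≟ v
    ... | yes refl | _        = withV A∈H x∈L y∈L x∈A y∈A x≢y
    ... | no _     | yes refl = withV A∈H y∈L x∈L y∈A x∈A (≢-sym x≢y)
    ... | no x≢v   | no y≢v   =
      fromRest A∈H (∈-filter⁺ (≢v? v) x∈L x≢v) (∈-filter⁺ (≢v? v) y∈L y≢v) x∈A y∈A x≢y

  -- Induction on the length, since the list filtered to drop `v` is not a structural part of `L`.
  colouring : ∀ L → AllPairs _⊏_ L → Acc ℕ._<_ (length L) → ∃ (ProperOn L)
  colouring [] _ _ = (λ _ → 0F) , λ _ ()
  colouring L@(_ ∷ _) sorted (acc rec) with v , v∈L , deg ← degreeAtMost2-exists sorted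
    with c , proper ← colouring (filter (≢v? v) L) (AllPairs.filter⁺ (≢v? v) sorted)
           (rec (filter-notAll (≢v? v) L (lose v∈L (λ v≢v → v≢v refl)))) =
    extend-to deg proper

  chromaticAtMost3 : ChromaticAtMost H 3
  chromaticAtMost3 with L , sorted , all ← sort (allFin m)
    with c , proper ← colouring L sorted (<-wellFounded (length L)) = c , bichromatic
    where
    bichromatic : ProperColoring H 3 c
    bichromatic E E∈H ∣E∣≥2
      with x , y , x≢y , x∈E , y∈E ← twoElements E ∣E∣≥2
      with x′ , y′ , _ , _ , p ← proper E∈H (all (∈-allFin x)) (all (∈-allFin y)) x∈E y∈E x≢y = x′ , y′ , p

ABA-free-chromatic : (F : Hypergraph n) → ABA-free F → ChromaticAtMost F 3
ABA-free-chromatic F aba = ABABColouring.chromaticAtMost3 <-isStrictTotalOrder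
  λ A∈F B∈F x<y y<z _ x∈A x∉B y∈B y∉A z∈A z∉B _ _ → aba _ _ A∈F B∈F _ _ _ x<y y<z x∈A x∉B z∈A z∉B y∈B y∉A

-- Duals of pseudohalfplane hypergraphs

-- Lexicographic order in which the set containing the first vertex of the symmetric difference is smaller.
data _≺_ : Subset n → Subset n → Set where
  first : {p q : Subset n} → (inside ∷ p) ≺ (outside ∷ q)
  next  : ∀ {s} {p q : Subset n} → p ≺ q → (s ∷ p) ≺ (s ∷ q)

≺-trans : {p q r : Subset n} → p ≺ q → q ≺ r → p ≺ r
≺-trans first    (next _)   = first
≺-trans (next _) first      = first
≺-trans (next a) (next b)   = next (≺-trans a b)

≺-cmp-next : ∀ {s} {p q : Subset n} → Tri (p ≺ q) (p ≡ q) (q ≺ p) →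
  Tri ((s ∷ p) ≺ (s ∷ q)) (s ∷ p ≡ s ∷ q) ((s ∷ q) ≺ (s ∷ p))
≺-cmp-next (tri< a b c) = tri< (next a) (b ∘ ∷-injectiveʳ) (λ { (next q≺p) → c q≺p })
≺-cmp-next (tri≈ a b c) = tri≈ (λ { (next p≺q) → a p≺q }) (cong (_ ∷_) b) (λ { (next q≺p) → c q≺p })
≺-cmp-next (tri> a b c) = tri> (λ { (next p≺q) → a p≺q }) (b ∘ ∷-injectiveʳ) (next c)

≺-cmp : Trichotomous _≡_ (_≺_ {n})
≺-cmp []            []            = tri≈ (λ ()) refl (λ ())
≺-cmp (inside  ∷ p) (outside ∷ q) = tri< first (λ ()) (λ ())
≺-cmp (outside ∷ p) (inside  ∷ q) = tri> (λ ()) (λ ()) first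
≺-cmp (inside  ∷ p) (inside  ∷ q) = ≺-cmp-next (≺-cmp p q)
≺-cmp (outside ∷ p) (outside ∷ q) = ≺-cmp-next (≺-cmp p q)

≺-firstDifference : {p q : Subset n} → p ≺ q →
  ∃ λ w → w ∈ p × w ∉ q × (∀ {v} → v ∈ q → v ∉ p → w < v)
≺-firstDifference first = zero , here , (λ ()) , λ { {zero} () ; {suc _} _ _ → z<s }
≺-firstDifference (next {s = s} p≺q) with w , w∈p , w∉q , least ← ≺-firstDifference p≺q =
  suc w , there w∈p , (λ { (there w∈q) → w∉q w∈q }) ,
  λ { here v∉p → contradiction here v∉p ; (there v∈q) v∉p → s<s (least v∈q (v∉p ∘ there)) }

-- If `v < u`, the first difference `w` of `p` and `q` precedes `v`, and `w`, `v`, `u` form an ABA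
-- pattern.
≺-ABA-free : {F : Hypergraph n} → ABA-free F → ∀ {p q u v} → p ∈ₗ F → q ∈ₗ F → p ≺ q →
  u ∈ p → u ∉ q → v ∈ q → v ∉ p → u < v
≺-ABA-free aba {u = u} {v} p∈F q∈F p≺q u∈p u∉q v∈q v∉p
  with w , w∈p , w∉q , least ← ≺-firstDifference p≺q with <-cmp u v
... | tri< u<v _ _  = u<v
... | tri≈ _ refl _ = contradiction u∈p v∉p
... | tri> _ _ v<u  = ⊥-elim (aba _ _ p∈F q∈F w v u (least v∈q v∉p) v<u w∈p w∉q u∈p u∉q v∈q v∉p)

lookup-injective : {H : Hypergraph n} → Unique H → ∀ i j → L.lookup H i ≡ L.lookup H j → i ≡ j
lookup-injective (_ ∷ _) zero zero _ = refl
lookup-injective {H = _ ∷ H} (p ∷ _) zero (suc j) eq = contradiction eq (All.lookup p (∈-lookup j))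
lookup-injective {H = _ ∷ H} (p ∷ _) (suc i) zero eq = contradiction (sym eq) (All.lookup p (∈-lookup i))
lookup-injective (_ ∷ u) (suc i) (suc j) eq = cong suc (lookup-injective u i j eq)

flipBy : Bool → Subset n → Subset n
flipBy true  A = A
flipBy false A = ∁ A

module DualColouring {H : Hypergraph n} (unique : Unique H) {F : Hypergraph n} (aba : ABA-free F)
  (cover : ∀ E → E ∈ₗ H → (E ∈ₗ F) ⊎ (∃[ G ] (G ∈ₗ F × E ≡ ∁ G))) where

  represent : ∀ i → ∃₂ λ s A → A ∈ₗ F × L.lookup H i ≡ flipBy s A
  represent i with cover (L.lookup H i) (∈-lookup i)
  ... | inj₁ E∈F = true , L.lookup H i , E∈F , refl
  ... | inj₂ (G , G∈F , eq) = false , G , G∈F , eq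

  -- The side is an extra leading coordinate, so one lexicographic comparison puts members (`true`,
  -- that is `inside`) before complements and sorts each class.
  key : Fin (length H) → Subset (suc n)
  key i = let s , A , _ = represent i in s ∷ A

  key-injective : ∀ {i j} → key i ≡ key j → i ≡ j
  key-injective {i} {j} eq with represent i | represent j
  key-injective {i} {j} refl | s , A , _ , eqᵢ | _ , _ , _ , eqⱼ = lookup-injective unique i j (trans eqᵢ (sym eqⱼ))

  isStrictTotalOrder : IsStrictTotalOrder _≡_ (_≺_ on key)
  isStrictTotalOrder = isStrictTotalOrderᶜ record
    { isEquivalence = isEquivalence ; trans = ≺-trans ; compare = compare }
    where
    compare : Trichotomous _≡_ (_≺_ on key)
    compare i j with ≺-cmp (key i) (key j)
    ... | tri< a b c = tri< a (b ∘ cong key) c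
    ... | tri≈ a b c = tri≈ a (key-injective b) c
    ... | tri> a b c = tri> a (b ∘ cong key) c

  -- Complementing Hᵢ and Hⱼ exchanges their differences, which reverses the order of u ∈ Hᵢ ∖ Hⱼ and v ∈ Hⱼ ∖ Hᵢ.
  Before : Bool → Fin n → Fin n → Set
  Before true  u v = u < v
  Before false u v = v < u

  sameSide : ∀ {s A B u v} → A ∈ₗ F → B ∈ₗ F → (s ∷ A) ≺ (s ∷ B) →
    u ∈ flipBy s A → v ∉ flipBy s A → v ∈ flipBy s B → u ∉ flipBy s B → Before s u v
  sameSide {true}  A∈F B∈F (next A≺B) u∈A v∉A v∈B u∉B = ≺-ABA-free aba A∈F B∈F A≺B u∈A u∉B v∈B v∉A
  sameSide {false} A∈F B∈F (next A≺B) u∈A v∉A v∈B u∉B =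
    ≺-ABA-free aba A∈F B∈F A≺B (x∉∁p⇒x∈p v∉A) (x∈∁p⇒x∉p v∈B) (x∉∁p⇒x∈p u∉B) (x∈∁p⇒x∉p u∈A)

  -- Consecutive sets on the same side fix the order of `u` and `v`. Four sorted sets have three
  -- consecutive ones on one side or split two and two; either way both orders are forced.
  alternation : ∀ {i j k l} u v → key i ≺ key j → key j ≺ key k → key k ≺ key l →
    u ∈ L.lookup H i → v ∉ L.lookup H i → v ∈ L.lookup H j → u ∉ L.lookup H j →
    u ∈ L.lookup H k → v ∉ L.lookup H k → v ∈ L.lookup H l → u ∉ L.lookup H l → ⊥
  alternation {i} {j} {k} {l} u v i≺j j≺k k≺l
    with represent i | represent j | represent k | represent l
  ... | si , A , A∈ , eA | sj , B , B∈ , eB | sk , C , C∈ , eC | sl , D , D∈ , eD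
    rewrite eA | eB | eC | eD = go si sj sk sl i≺j j≺k k≺l
    where
    go : ∀ si sj sk sl → (si ∷ A) ≺ (sj ∷ B) → (sj ∷ B) ≺ (sk ∷ C) → (sk ∷ C) ≺ (sl ∷ D) →
      u ∈ flipBy si A → v ∉ flipBy si A → v ∈ flipBy sj B → u ∉ flipBy sj B →
      u ∈ flipBy sk C → v ∉ flipBy sk C → v ∈ flipBy sl D → u ∉ flipBy sl D → ⊥
    go true true true _ ij jk _ uA vA vB uB uC vC _ _ =
      <-asym (sameSide A∈ B∈ ij uA vA vB uB) (sameSide B∈ C∈ jk vB uB uC vC)
    go true true false false ij _ kl uA vA vB uB uC vC vD uD =
      <-asym (sameSide A∈ B∈ ij uA vA vB uB) (sameSide C∈ D∈ kl uC vC vD uD)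
    go _ false false false _ jk kl _ _ vB uB uC vC vD uD =
      <-asym (sameSide B∈ C∈ jk vB uB uC vC) (sameSide C∈ D∈ kl uC vC vD uD)
    -- A complement never precedes a member.
    go false true _ _ () _ _
    go _ false true _ _ () _
    go _ _ false true _ _ ()

  dualEdge : Fin n → Subset (length H)
  dualEdge v = tabulate (λ i → lookup (L.lookup H i) v)

  ∈-dualEdge⁻ : ∀ {i v} → i ∈ dualEdge v → v ∈ L.lookup H i
  ∈-dualEdge⁻ {i} {v} i∈ = lookup⇒[]= v _ (trans (sym (lookup∘tabulate _ i)) ([]=⇒lookup i∈))

  ∈-dualEdge⁺ : ∀ {i v} → v ∈ L.lookup H i → i ∈ dualEdge v
  ∈-dualEdge⁺ {i} {v} v∈ = lookup⇒[]= i _ (trans (lookup∘tabulate _ i) ([]=⇒lookup v∈))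

  -- The dual hyperedges come from vertices `u` and `v`; the pattern says that four sorted
  -- hyperedges alternately contain only `u` and only `v`.
  dual-ABAB-free : ABAB-free (_≺_ on key) (dual H)
  dual-ABAB-free A∈ B∈ i≺j j≺k k≺l iA iB jB jA kA kB lB lA
    with u , _ , refl ← ∈-map⁻ _ A∈ | v , _ , refl ← ∈-map⁻ _ B∈ =
    alternation u v i≺j j≺k k≺l
      (∈-dualEdge⁻ iA) (iB ∘ ∈-dualEdge⁺) (∈-dualEdge⁻ jB) (jA ∘ ∈-dualEdge⁺)
      (∈-dualEdge⁻ kA) (kB ∘ ∈-dualEdge⁺) (∈-dualEdge⁻ lB) (lA ∘ ∈-dualEdge⁺)

  dual-chromatic : ChromaticAtMost (dual H) 3
  dual-chromatic = ABABColouring.chromaticAtMost3 isStrictTotalOrder dual-ABAB-free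

∈-image⁺ : (f : Fin k ↔ Fin m) {E : Subset k} → ∀ {x} → x ∈ E → Inverse.to f x ∈ image f E
∈-image⁺ f {E} {x} x∈E = lookup⇒[]= _ _
  (trans (lookup∘tabulate _ (Inverse.to f x)) (trans (cong (lookup E) (Inverse.strictlyInverseʳ f x)) ([]=⇒lookup x∈E)))

∈-image⁻ : (f : Fin k ↔ Fin m) {E : Subset k} → ∀ {y} → y ∈ image f E → Inverse.from f y ∈ E
∈-image⁻ f {E} {y} y∈ = lookup⇒[]= _ _ (trans (sym (lookup∘tabulate _ y)) ([]=⇒lookup y∈))

twoElements⁻ : (E : Subset n) → ∀ {x y} → x ≢ y → x ∈ E → y ∈ E → ∣ E ∣ ≥ 2
twoElements⁻ E {x} {y} x≢y x∈E y∈E =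
  ℕ.≤-trans (s≤s (ℕ.≤-trans (s≤s z≤n) (x∈p⇒∣p-x∣<∣p∣ (x∈p∧x≢y⇒x∈p-y y∈E (≢-sym x≢y))))) (x∈p⇒∣p-x∣<∣p∣ x∈E)

Isomorphic-colourable : {G : Hypergraph k} {D : Hypergraph m} → Isomorphic G D → ∀ c → ChromaticAtMost D c → ChromaticAtMost G c
Isomorphic-colourable (f , to∈ , _) _ (c , proper) = c ∘ Inverse.to f , proper′
  where
  proper′ : ProperColoring _ _ (c ∘ Inverse.to f)
  proper′ E E∈G ∣E∣≥2 with x , y , x≢y , x∈E , y∈E ← twoElements E ∣E∣≥2
    with x′ , y′ , x′∈ , y′∈ , cx′≢cy′ ← proper (image f E) (to∈ E E∈G)
      (twoElements⁻ _ (x≢y ∘ Injection.injective (↔⇒↣ f)) (∈-image⁺ f x∈E) (∈-image⁺ f y∈E)) =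
    Inverse.from f x′ , Inverse.from f y′ , ∈-image⁻ f x′∈ , ∈-image⁻ f y′∈ ,
    λ eq → cx′≢cy′ (trans (cong c (sym (Inverse.strictlyInverseˡ f x′))) (trans eq (cong c (Inverse.strictlyInverseˡ f y′))))

dualPseudohalfplane-chromatic : (G : Hypergraph m) → DualPseudohalfplane G → ChromaticAtMost G 3
dualPseudohalfplane-chromatic G (_ , H , unique , (F , aba , cover) , iso) =
  Isomorphic-colourable iso 3 (DualColouring.dual-chromatic unique aba cover)

-- Unskippable vertices

_∈ₗ?_ : (v : Fin n) (L : List (Fin n)) → Dec (v ∈ₗ L)
_∈ₗ?_ = DecMembership._∈?_ _≟_

-- `P` restricts the two flanking vertices, which models deleting vertices without changing the
-- family; the order is a parameter so that it can be reversed.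
SkippedWithin : Rel (Fin n) 0ℓ → Hypergraph n → Pred (Fin n) 0ℓ → Fin n → Set
SkippedWithin _⊏_ F P v = ∃ λ D → D ∈ₗ F × v ∉ D × ∃₂ λ x z → x ⊏ v × v ⊏ z × x ∈ D × z ∈ D × P x × P z

SkippedWithin-flip : ∀ {_⊏_ : Rel (Fin n) 0ℓ} {F P v} → SkippedWithin _⊏_ F P v → SkippedWithin (flip _⊏_) F P v
SkippedWithin-flip (D , D∈F , v∉D , x , z , x⊏v , v⊏z , x∈D , z∈D , px , pz) =
  D , D∈F , v∉D , z , x , v⊏z , x⊏v , z∈D , x∈D , pz , px

ABA-freeFor : Rel (Fin n) 0ℓ → Hypergraph n → Set
ABA-freeFor _⊏_ F = ∀ A B → A ∈ₗ F → B ∈ₗ F → ∀ x y z → x ⊏ y → y ⊏ z →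
  x ∈ A → x ∉ B → z ∈ A → z ∉ B → y ∈ B → y ∉ A → ⊥

-- Here `v` was the left flank of `w` in `D`. If `l ∈ D`, then `l` replaces `v`. Otherwise
-- ABA-freeness at `l`, `v` forces all later elements of `B` into `D`: so `w ∉ B`, and `w` is
-- flanked by `l` and `r` in `B` or by `r` and `z` in `D`.
bypassLeft : ∀ {_⊏_ : Rel (Fin n) 0ℓ} → IsStrictTotalOrder _≡_ _⊏_ → ∀ {F} → ABA-freeFor _⊏_ F → ∀ {P v w D z} →
  SkippedWithin _⊏_ F P v → D ∈ₗ F → w ∉ D → v ⊏ w → w ⊏ z → v ∈ D → z ∈ D → P z →
  SkippedWithin _⊏_ F (λ u → P u × u ≢ v) w
bypassLeft {_⊏_ = _⊏_} isSTO aba {v = v} {w} {D} {z}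
  (B , B∈F , v∉B , l , r , l⊏v , v⊏r , l∈B , r∈B , pl , pr) D∈F w∉D v⊏w w⊏z v∈D z∈D pz = go (l ∈? D)
  where
  open IsStrictTotalOrder isSTO using (compare; irrefl) renaming (trans to ⊏-trans)
  z≢v : z ≢ v
  z≢v refl = irrefl refl (⊏-trans v⊏w w⊏z)
  l≢v : l ≢ v
  l≢v refl = irrefl refl l⊏v
  r≢v : r ≢ v
  r≢v refl = irrefl refl v⊏r
  clash : ∀ {t} → l ∉ D → v ⊏ t → t ∈ B → t ∉ D → ⊥
  clash l∉D v⊏t t∈B t∉D = aba B D B∈F D∈F l v _ l⊏v v⊏t l∈B l∉D t∈B t∉D v∈D v∉B
  go : Dec (l ∈ D) → SkippedWithin _⊏_ _ _ w
  go (yes l∈D) = D , D∈F , w∉D , l , z , ⊏-trans l⊏v v⊏w , w⊏z , l∈D , z∈D , (pl , l≢v) , (pz , z≢v)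
  go (no l∉D) with compare w r
  ... | tri≈ _ refl _ = ⊥-elim (clash l∉D v⊏w r∈B w∉D)
  ... | tri< w⊏r _ _ = B , B∈F , (λ w∈B → clash l∉D v⊏w w∈B w∉D) , l , r ,
    ⊏-trans l⊏v v⊏w , w⊏r , l∈B , r∈B , (pl , l≢v) , (pr , r≢v)
  ... | tri> _ _ r⊏w = D , D∈F , w∉D , r , z , r⊏w , w⊏z ,
    decidable-stable (r ∈? D) (clash l∉D v⊏r r∈B) , z∈D , (pr , r≢v) , (pz , z≢v)

bypass : {F : Hypergraph n} → ABA-free F → ∀ {P v w} → SkippedWithin _<_ F P v → SkippedWithin _<_ F P w →
  SkippedWithin _<_ F (λ u → P u × u ≢ v) w
bypass aba {v = v} sv (D , D∈F , w∉D , x , z , x<w , w<z , x∈D , z∈D , px , pz) with x ≟ v | z ≟ v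
... | yes refl | _ = bypassLeft <-isStrictTotalOrder aba sv D∈F w∉D x<w w<z x∈D z∈D pz
-- A right flank is a left flank in the reversed order.
... | no _ | yes refl = SkippedWithin-flip {_⊏_ = flip _<_} (bypassLeft (Flip.isStrictTotalOrder <-isStrictTotalOrder)
  (λ A B A∈ B∈ x y z x>y y>z xA xB zA zB → aba A B A∈ B∈ z y x y>z x>y zA zB xA xB)
  (SkippedWithin-flip {_⊏_ = _<_} sv) D∈F w∉D w<z x<w z∈D x∈D px)
... | no x≢v | no z≢v = D , D∈F , w∉D , x , z , x<w , w<z , x∈D , z∈D , (px , x≢v) , (pz , z≢v)

Skippable : Hypergraph n → Fin n → Set
Skippable F v = Any (λ D → v ∉ D × (∃ λ x → x < v × x ∈ D) × (∃ λ z → v < z × z ∈ D)) F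

skippable? : (F : Hypergraph n) → Decidable (Skippable F)
skippable? F v = Any.any? (λ D → ¬? (v ∈? D) ×-dec any? (λ x → x <? v ×-dec x ∈? D)
  ×-dec any? (λ z → v <? z ×-dec z ∈? D)) F

Unskippable : Hypergraph n → Fin n → Set
Unskippable F v = ¬ Skippable F v

unskippable? : (F : Hypergraph n) → Decidable (Unskippable F)
unskippable? F v = ¬? (skippable? F v)

SkippedWithin-map : {F : Hypergraph n} {P Q : Pred (Fin n) 0ℓ} → (∀ {u} → P u → Q u) → ∀ {v} →
  SkippedWithin _<_ F P v → SkippedWithin _<_ F Q v
SkippedWithin-map f (D , D∈F , v∉D , x , z , x<v , v<z , x∈D , z∈D , px , pz) =
  D , D∈F , v∉D , x , z , x<v , v<z , x∈D , z∈D , f px , f pz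

-- Vertices are deleted one at a time: `v` and `w` are both still skipped outside the tail, and
-- `bypass` then frees `w` from `v`.
skippedAvoiding : {F : Hypergraph n} → ABA-free F → ∀ L → All (Skippable F) L → ∀ {w} → Skippable F w →
  w ∉ₗ L → SkippedWithin _<_ F (_∉ₗ L) w
skippedAvoiding aba [] [] sw _ with D , D∈F , w∉D , (x , x<w , x∈D) , (z , w<z , z∈D) ← find sw =
  D , D∈F , w∉D , x , z , x<w , w<z , x∈D , z∈D , (λ ()) , (λ ())
skippedAvoiding aba (v ∷ L) (sv ∷ sL) sw w∉ with v ∈ₗ? L
... | yes v∈L = SkippedWithin-map (λ { u∉L (here refl) → u∉L v∈L ; u∉L (there u∈L) → u∉L u∈L })
  (skippedAvoiding aba L sL sw (w∉ ∘ there))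
... | no v∉L = SkippedWithin-map (λ { (u∉L , u≢v) (here u≡v) → u≢v u≡v ; (u∉L , _) (there u∈L) → u∉L u∈L })
  (bypass aba (skippedAvoiding aba L sL sv v∉L) (skippedAvoiding aba L sL sw (w∉ ∘ there)))

-- If all elements of A were skippable, then a ∈ A would be skipped by some D through vertices outside
-- A ∖ {a}, and so D and A would form a forbidden pattern.
unskippable-exists : {F : Hypergraph n} → ABA-free F → ∀ {A a} → A ∈ₗ F → a ∈ A → ∃ λ u → u ∈ A × Unskippable F u
unskippable-exists {n} {F} aba {A} {a} A∈F a∈A with any? (λ u → u ∈? A ×-dec unskippable? F u)
... | yes p = p
... | no ¬p = ⊥-elim (pattern-found (skippedAvoiding aba others
    (All.tabulate (λ u∈ → skippable (proj₁ (proj₂ (∈-filter⁻ other? {xs = allFin n} u∈)))))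
    (skippable a∈A) (λ a∈ → proj₂ (proj₂ (∈-filter⁻ other? {xs = allFin n} a∈)) refl)))
  where
  other? : Decidable (λ u → u ∈ A × u ≢ a)
  other? u = u ∈? A ×-dec ¬? (u ≟ a)
  others = filter other? (allFin n)
  skippable : ∀ {u} → u ∈ A → Skippable F u
  skippable {u} u∈A = decidable-stable (skippable? F u) (λ ¬s → ¬p (u , u∈A , ¬s))
  outsideA : ∀ {t} → t ∉ₗ others → t ≢ a → t ∉ A
  outsideA t∉ t≢a t∈A = t∉ (∈-filter⁺ other? (∈-allFin _) (t∈A , t≢a))
  pattern-found : ¬ SkippedWithin _<_ F (_∉ₗ others) a
  pattern-found (D , D∈F , a∉D , x , z , x<a , a<z , x∈D , z∈D , x∉others , z∉others) =
    aba D A D∈F A∈F x a z x<a a<z x∈D (outsideA x∉others (<⇒≢ x<a)) z∈D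
      (outsideA z∉others (≢-sym (<⇒≢ a<z))) a∈A a∉D

unskippable-convex : ∀ {F : Hypergraph n} {A v x z} → A ∈ₗ F → Unskippable F v → x < v → v < z → x ∈ A → z ∈ A → v ∈ A
unskippable-convex {A = A} {v} A∈F unsk x<v v<z x∈A z∈A =
  decidable-stable (v ∈? A) λ v∉A → unsk (lose A∈F (v∉A , (_ , x<v , x∈A) , (_ , v<z , z∈A)))

-- The two extreme vertices lie on every path; they end the runs along the path of `F′` in
-- `bichromatic`.
zero-unskippable : (F : Hypergraph (suc n)) → Unskippable F zero
zero-unskippable F s with _ , _ , _ , (_ , () , _) , _ ← find s

fromℕ-unskippable : (F : Hypergraph (suc n)) → Unskippable F (fromℕ n)
fromℕ-unskippable F s with _ , _ , _ , _ , (z , n<z , _) ← find s = ℕ.<⇒≱ n<z (≤fromℕ z)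

-- Colouring along monotone paths

least : {P : Pred (Fin n) 0ℓ} → Decidable P → ∃ P → ∃ λ x → P x × (∀ z → z < x → ¬ P z)
least {suc n} P? (x , px) with P? zero
... | yes p₀ = zero , p₀ , λ _ ()
least {suc n} P? (zero  , px) | no ¬p₀ = contradiction px ¬p₀
least {suc n} P? (suc x , px) | no ¬p₀ with y , py , below ← least (P? ∘ suc) (x , px) =
  suc y , py , λ { zero _ → ¬p₀ ; (suc z) (s<s z<y) → below z z<y }

Consecutive : Pred (Fin n) 0ℓ → Fin n → Fin n → Set
Consecutive U x y = x < y × U x × U y × (∀ z → x < z → z < y → ¬ U z)

SeparatesConsecutive : {C : Set} → Pred (Fin n) 0ℓ → (Fin n → C) → Set
SeparatesConsecutive U c = ∀ {x y} → Consecutive U x y → c x ≢ c y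

-- Colouring the vertices from the last to the first, each vertex has at most one successor in each of the k sets.
greedy : (U : Fin k → Pred (Fin n) 0ℓ) → (∀ i → Decidable (U i)) →
  ∃ λ (c : Fin n → Fin (suc k)) → ∀ i → SeparatesConsecutive (U i) c
greedy {n = zero} U U? = (λ ()) , λ { _ {()} }
greedy {k} {suc n} U U? with c , proper ← greedy (λ i → U i ∘ suc) (λ i → U? i ∘ suc) = c′ , proper′
  where
  successor : ∀ i → Dec (∃ (U i ∘ suc)) → Fin (suc k)
  successor i (yes p) = c (proj₁ (least (U? i ∘ suc) p))
  -- An arbitrary colour: no consecutive pair of this set starts at the new vertex.
  successor i (no _)  = zero
  successorColour : Fin k → Fin (suc k)
  successorColour i = successor i (any? (U? i ∘ suc))

  successor-≡ : ∀ i {y} d → U i (suc y) → (∀ z → z < y → ¬ U i (suc z)) → successor i d ≡ c y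
  successor-≡ i {y} (no ¬p) uy _ = contradiction (y , uy) ¬p
  successor-≡ i {y} (yes p) uy min with x , ux , below ← least (U? i ∘ suc) p with <-cmp x y
  ... | tri< x<y _ _  = contradiction ux (min x x<y)
  ... | tri≈ _ refl _ = refl
  ... | tri> _ _ y<x  = contradiction uy (below y y<x)

  c′ : Fin (suc n) → Fin (suc k)
  c′ zero    = proj₁ (freshColour successorColour)
  c′ (suc x) = c x

  proper′ : ∀ i → SeparatesConsecutive (U i) c′
  proper′ i {zero} {suc y} (_ , _ , uy , between) eq =
    proj₂ (freshColour successorColour) i
      (trans eq (sym (successor-≡ i (any? (U? i ∘ suc)) uy (λ z z<y → between (suc z) z<s (s<s z<y)))))
  proper′ i {suc x} {suc y} (s<s x<y , ux , uy , between) =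
    proper i (x<y , ux , uy , λ z x<z z<y → between (suc z) (s<s x<z) (s<s z<y))

-- `x` is compared with its successor `w` in `U`, since the colours of `x` and `y` may agree; `w` is
-- `y` or lies between them.
separates-between : ∀ {C : Set} {U : Pred (Fin n) 0ℓ} {c : Fin n → C} {A x y} → Decidable U → SeparatesConsecutive U c →
  U x → U y → x < y → x ∈ A → y ∈ A → (∀ {z} → U z → x < z → z < y → z ∈ A) → Separates c A
separates-between {A = A} {x} {y} U? sep ux uy x<y x∈A y∈A convex
  with w , (x<w , uw) , below ← least (λ w → x <? w ×-dec U? w) (y , x<y , uy) =
  x , w , x∈A , w∈A , sep (x<w , ux , uw , λ z x<z z<w uz → below z z<w (x<z , uz))
  where
  w∈A : w ∈ A
  w∈A with <-cmp w y
  ... | tri< w<y _ _  = convex uw x<w w<y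
  ... | tri≈ _ refl _ = y∈A
  ... | tri> _ _ y<w  = contradiction (x<y , uy) (below y y<w)

-- Take an unskippable `a ∈ A` and another `b ∈ A`. If `b` is on the path of `F`, use the run
-- between them; if on neither path, use `inner`; if only on that of `F′`, use a run of `F′` from
-- `b` to an extreme vertex.
bichromatic : ∀ {n} {C : Set} {c : Fin n → C} {F F′ : Hypergraph n} → ABA-free F →
  SeparatesConsecutive (Unskippable F) c → SeparatesConsecutive (Unskippable F′) c →
  (∀ {a b} → Unskippable F a → ¬ Unskippable F b → ¬ Unskippable F′ b → c a ≢ c b) →
  ∀ {A} → A ∈ₗ F → ∁ A ∈ₗ F′ → ∣ A ∣ ≥ 2 → Separates c A
bichromatic {zero} _ _ _ _ {[]} _ _ ()
bichromatic {suc n} {c = c} {F} {F′} aba sep sep′ inner {A} A∈F ∁A∈F′ ∣A∣≥2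
  with x , y , x≢y , x∈A , y∈A ← twoElements A ∣A∣≥2
  with a , a∈A , ua ← unskippable-exists aba A∈F x∈A =
  withOther (other (x ≟ a))
  where
  other : Dec (x ≡ a) → ∃ λ b → b ∈ A × b ≢ a
  other (yes refl) = y , y∈A , ≢-sym x≢y
  other (no x≢a)   = x , x∈A , x≢a

  withOther : (∃ λ b → b ∈ A × b ≢ a) → Separates c A
  withOther (b , b∈A , b≢a) with unskippable? F b
  ... | yes ub with <-cmp a b
  ...   | tri< a<b _ _ = separates-between (unskippable? F) sep ua ub a<b a∈A b∈A
                           (λ uz a<z z<b → unskippable-convex A∈F uz a<z z<b a∈A b∈A)
  ...   | tri≈ _ a≡b _ = contradiction (sym a≡b) b≢a
  ...   | tri> _ _ b<a = separates-between (unskippable? F) sep ub ua b<a b∈A a∈A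
                           (λ uz b<z z<a → unskippable-convex A∈F uz b<z z<a b∈A a∈A)
  withOther (b , b∈A , b≢a) | no ¬ub with unskippable? F′ b
  ... | no ¬u′b = a , b , a∈A , b∈A , inner ua ¬ub ¬u′b
  ... | yes u′b with any? (λ t → unskippable? F′ t ×-dec t <? b ×-dec ¬? (t ∈? A))
  ...   | no ¬p = separates-between (unskippable? F′) sep′ (zero-unskippable F′) u′b 0<b
                    (belowIn (zero-unskippable F′) 0<b) b∈A (λ uz _ z<b → belowIn uz z<b)
    where
    0<b : Fin.zero {n} < b
    -- `b` is skippable for `F`, hence not extreme, so the run has two ends.
    0<b = ≤∧≢⇒< z≤n λ { refl → ¬ub (zero-unskippable F) }
    belowIn : ∀ {t} → Unskippable F′ t → t < b → t ∈ A
    belowIn {t} ut t<b = decidable-stable (t ∈? A) (λ t∉A → ¬p (t , ut , t<b , t∉A))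
  ...   | yes (t , ut , t<b , t∉A) = separates-between (unskippable? F′) sep′ u′b (fromℕ-unskippable F′) b<n
                    b∈A (aboveIn b<n) (λ _ b<z _ → aboveIn b<z)
    where
    b<n : b < fromℕ n
    b<n = ≤∧≢⇒< (≤fromℕ b) λ { refl → ¬ub (fromℕ-unskippable F) }
    aboveIn : ∀ {z} → b < z → z ∈ A
    -- Otherwise `∁ A` has elements `t` and `z` on both sides of `b` and must contain `b`.
    aboveIn {z} b<z = decidable-stable (z ∈? A) λ z∉A →
      x∈∁p⇒x∉p (unskippable-convex ∁A∈F′ u′b t<b b<z (x∉p⇒x∈∁p t∉A) (x∉p⇒x∈∁p z∉A)) b∈A

-- Four colours for pseudohalfplane hypergraphs

∁-involutive : (A : Subset n) → ∁ (∁ A) ≡ A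
∁-involutive A = trans (sym (map-∘ not not A)) (trans (map-cong not-involutive A) (map-id A))

-- Complementation exchanges the two differences, so the sets swap roles.
complements-ABA-free : {F : Hypergraph n} → ABA-free F → ABA-free (L.map ∁ F)
complements-ABA-free aba A B A∈ B∈ x y z x<y y<z x∈A x∉B z∈A z∉B y∈B y∉A
  with A′ , A′∈ , refl ← ∈-map⁻ ∁ A∈ | B′ , B′∈ , refl ← ∈-map⁻ ∁ B∈ =
  aba B′ A′ B′∈ A′∈ x y z x<y y<z (x∉∁p⇒x∈p x∉B) (x∈∁p⇒x∉p x∈A) (x∉∁p⇒x∈p z∉B) (x∈∁p⇒x∉p z∈A)
    (x∉∁p⇒x∈p y∉A) (x∈∁p⇒x∉p y∈B)

pseudohalfplane-chromatic : (H : Hypergraph n) → Pseudohalfplane H → ChromaticAtMost H 4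
pseudohalfplane-chromatic {n} H (F , aba , cover) = c , proper
  where
  F̄ = L.map ∁ F

  path : Fin 2 → Pred (Fin n) 0ℓ
  path 0F = Unskippable F
  path 1F = Unskippable F̄

  path? : ∀ i → Decidable (path i)
  path? 0F = unskippable? F
  path? 1F = unskippable? F̄

  onPath? : ∀ v → Dec (∃ λ i → path i v)
  onPath? v = any? (λ i → path? i v)

  paths = greedy path path?

  colour : ∀ v → Dec (∃ λ i → path i v) → Fin 4
  colour v (yes _) = inject₁ (proj₁ paths v)
  -- The fourth colour, outside the image of `inject₁`.
  colour v (no _)  = fromℕ 3

  c : Fin n → Fin 4
  c v = colour v (onPath? v)

  c-onPath : ∀ {i v} → path i v → c v ≡ inject₁ (proj₁ paths v)
  c-onPath {i} {v} pv with onPath? v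
  ... | yes _ = refl
  ... | no ¬p = contradiction (i , pv) ¬p

  c-separates : ∀ i → SeparatesConsecutive (path i) c
  c-separates i con@(_ , px , py , _) eq =
    proj₂ paths i con (inject₁-injective (trans (sym (c-onPath {i} px)) (trans eq (c-onPath {i} py))))

  c-inner : ∀ i {a b} → path i a → (∀ j → ¬ path j b) → c a ≢ c b
  c-inner i {a} {b} pa ¬pb eq with onPath? b
  ... | yes (j , pb) = ¬pb j pb
  ... | no _ = fromℕ≢inject₁ (trans (sym eq) (c-onPath {i} pa))

  proper : ProperColoring H 4 c
  proper E E∈H ∣E∣≥2 with cover E E∈H
  ... | inj₁ E∈F = bichromatic aba (c-separates 0F) (c-separates 1F)
    (λ ua ¬u ¬u′ → c-inner 0F ua λ { 0F → ¬u ; 1F → ¬u′ }) E∈F (∈-map⁺ ∁ E∈F) ∣E∣≥2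
  -- For a complement the two paths swap roles.
  ... | inj₂ (G , G∈F , refl) = bichromatic (complements-ABA-free aba) (c-separates 1F) (c-separates 0F)
    (λ ua ¬u ¬u′ → c-inner 1F ua λ { 0F → ¬u′ ; 1F → ¬u }) (∈-map⁺ ∁ G∈F)
    (subst (_∈ₗ F) (sym (∁-involutive G)) G∈F) ∣E∣≥2

-- Sharpness

-- Quantifying over list entries and vertices makes the condition decidable by search, so concrete
-- families are checked by evaluation.
ABA-free? : (F : Hypergraph n) → Dec (All (λ A → All (λ B → ∀ x y z → x < y → y < z →
  x ∈ A → x ∉ B → z ∈ A → z ∉ B → y ∈ B → ¬ (y ∉ A)) F) F)
ABA-free? F = All.all? (λ A → All.all? (λ B → all? λ x → all? λ y → all? λ z →
  x <? y →-dec y <? z →-dec x ∈? A →-dec ¬? (x ∈? B) →-dec z ∈? A →-dec ¬? (z ∈? B) →-dec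
  y ∈? B →-dec ¬? (¬? (y ∈? A))) F) F

ABA-free-by-decision : (F : Hypergraph n) → {True (ABA-free? F)} → ABA-free F
ABA-free-by-decision F {t} A B A∈F B∈F = All.lookup (All.lookup (toWitness t) A∈F) B∈F

pair : Fin n → Fin n → Subset n
pair x y = ⁅ x ⁆ ∪ ⁅ y ⁆

ContainsAllPairs : Hypergraph n → Set
ContainsAllPairs H = ∀ x y → x < y → pair x y ∈ₗ H × ∣ pair x y ∣ ≥ 2

containsAllPairs? : (H : Hypergraph n) → Dec (ContainsAllPairs H)
containsAllPairs? H = all? λ x → all? λ y → x <? y →-dec
  (DecMembership._∈?_ (≡-dec Bool._≟_) (pair x y) H ×-dec ∣ pair x y ∣ ≥? 2)

-- With `k` colours two vertices agree, and their pair is a monochromatic hyperedge.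
allPairs-chromatic : (H : Hypergraph (suc k)) → ContainsAllPairs H → ChromaticEq H (suc k)
allPairs-chromatic {k} H pairs = (id , identityProper) , notColourable
  where
  identityProper : ProperColoring H (suc k) id
  identityProper E _ ∣E∣≥2 with x , y , x≢y , x∈E , y∈E ← twoElements E ∣E∣≥2 = x , y , x∈E , y∈E , x≢y

  notColourable : ¬ Colorable H k
  notColourable (c , proper) with x , y , x<y , cx≡cy ← pigeonhole (ℕ.n<1+n k) c
    with u , v , u∈ , v∈ , cu≢cv ← proper (pair x y) (proj₁ (pairs x y x<y)) (proj₂ (pairs x y x<y)) =
    cu≢cv (trans (colour-x u∈) (sym (colour-x v∈)))
    where
    colour-x : ∀ {w} → w ∈ pair x y → c w ≡ c x
    colour-x w∈ with x∈p∪q⁻ ⁅ x ⁆ ⁅ y ⁆ w∈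
    ... | inj₁ w∈x = cong c (x∈⁅y⁆⇒x≡y x w∈x)
    ... | inj₂ w∈y = trans (cong c (x∈⁅y⁆⇒x≡y y w∈y)) (sym cx≡cy)

Isomorphic-refl : (G : Hypergraph n) → Isomorphic G G
Isomorphic-refl {n} G = ↔-id (Fin n) ,
  (λ E E∈G → subst (_∈ₗ G) (sym (image-id E)) E∈G) , λ E E∈G → E , E∈G , image-id E
  where
  image-id : ∀ E → image (↔-id (Fin n)) E ≡ E
  image-id = tabulate∘lookup

triangle : Hypergraph 3
triangle =
  (inside  ∷ inside  ∷ outside ∷ []) ∷
  (inside  ∷ outside ∷ inside  ∷ []) ∷
  (outside ∷ inside  ∷ inside  ∷ []) ∷ []

triangle-ABA-free : ABA-free triangle
triangle-ABA-free = ABA-free-by-decision triangle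

sharp-ABA-free : ∃[ n ] ∃[ F ] (ABA-free {n} F × ChromaticEq F 3)
sharp-ABA-free = 3 , triangle , triangle-ABA-free , allPairs-chromatic triangle (toWitness {a? = containsAllPairs? triangle} _)

sharp-dual : ∃[ m ] ∃[ G ] (DualPseudohalfplane {m} G × ChromaticEq G 3)
-- Any two edges of a triangle share a vertex, so the dual again has all pairs.
sharp-dual = 3 , dual triangle ,
  (3 , triangle , toWitness {a? = unique? (≡-dec Bool._≟_) triangle} _ ,
    (triangle , triangle-ABA-free , λ _ → inj₁) , Isomorphic-refl (dual triangle)) ,
  allPairs-chromatic (dual triangle) (toWitness {a? = containsAllPairs? (dual triangle)} _)

-- The three pairs in this family and their complements are all the pairs of four vertices.
paddedTriangle : Hypergraph 4
paddedTriangle = L.map (λ E → E ∷ʳ outside) triangle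

sharp-pseudohalfplane : ∃[ n ] ∃[ H ] (Pseudohalfplane {n} H × ChromaticEq H 4)
sharp-pseudohalfplane = 4 , H , (F , ABA-free-by-decision F , cover) , allPairs-chromatic H (toWitness {a? = containsAllPairs? H} _)
  where
  F = paddedTriangle
  H = F ++ L.map ∁ F
  cover : ∀ E → E ∈ₗ H → _
  cover E E∈H with ∈-++⁻ F E∈H
  ... | inj₁ E∈F = inj₁ E∈F
  ... | inj₂ E∈F̄ with G , G∈F , eq ← ∈-map⁻ ∁ E∈F̄ = inj₂ (G , G∈F , eq)

mainTheorem10 :
  (∀ (n : ℕ) (F : Hypergraph n) → ABA-free F → ChromaticAtMost F 3) ×
  (∀ (n : ℕ) (H : Hypergraph n) → Pseudohalfplane H → ChromaticAtMost H 4) ×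
  (∀ (m : ℕ) (G : Hypergraph m) → DualPseudohalfplane G → ChromaticAtMost G 3) ×
  (∃[ n ] ∃[ F ] (ABA-free {n} F × ChromaticEq F 3)) ×
  (∃[ m ] ∃[ G ] (DualPseudohalfplane {m} G × ChromaticEq G 3)) ×
  (∃[ n ] ∃[ H ] (Pseudohalfplane {n} H × ChromaticEq H 4))
mainTheorem10 =
  (λ _ → ABA-free-chromatic) ,
  (λ _ → pseudohalfplane-chromatic) ,
  (λ _ → dualPseudohalfplane-chromatic) ,
  sharp-ABA-free ,
  sharp-dual ,
  sharp-pseudohalfplane
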